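{- Let $G$ be a finite simple graph on at least $3$ vertices. If $G$ is $3$-tough and $(K_2 \cup 3K_1)$-free, then $G$ is hamiltonian.
   Context: For a graph $G$, $c(G)$ denotes the number of connected components of $G$. A cut set of $G$ is a set $S \subseteq V(G)$ such that $G-S$ is disconnected. For a real number $t \ge 0$, $G$ is $t$-tough if $t\cdot c(G-S) \le |S|$ for every cut set $S$ of $G$. $G$ is hamiltonian if it has a cycle containing every vertex. $G$ is $H$-free if it contains no induced subgraph isomorphic to $H$. $K_2 \cup 3K_1$ denotes the disjoint union of an edge and three isolated vertices (a graph on 5 vertices with exactly one edge). -}

module Defs where

open import Level using (0ℓ)
open import Data.Nat using (ℕ; zero; suc; _*_; _≤_; _≥_)
open import Data.Fin using (Fin; zero; suc; inject₁; fromℕ)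
open import Data.Fin.Subset using (Subset; _∈_; _∉_; ∣_∣)
open import Data.Fin.Permutation using (Permutation′; _⟨$⟩ʳ_)
open import Data.Product using (Σ; _×_; _,_)
open import Data.Empty using (⊥)
open import Relation.Nullary using (¬_; Dec)
open import Relation.Binary.PropositionalEquality using (_≡_; _≢_)
open import Relation.Binary.Construct.Closure.ReflexiveTransitive using (Star)
open import Function.Definitions using (Injective)
open import Function.Bundles using (_⇔_)

record Graph (n : ℕ) : Set₁ where
  field
    Adj   : Fin n → Fin n → Set
    adj?  : ∀ u v → Dec (Adj u v)
    sym   : ∀ {u v} → Adj u v → Adj v u
    irrefl : ∀ {u} → ¬ Adj u u
open Graph public

AdjMinus : ∀ {n} → Graph n → Subset n → Fin n → Fin n → Set
AdjMinus G S u v = u ∉ S × v ∉ S × Adj G u v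

ConnectedIn : ∀ {n} → Graph n → Subset n → Fin n → Fin n → Set
ConnectedIn G S u v = u ∉ S × v ∉ S × Star (AdjMinus G S) u v

AtLeastComponents : ∀ {n} → Graph n → Subset n → ℕ → Set
AtLeastComponents {n} G S k =
  Σ (Fin k → Fin n) λ r →
    (∀ i → r i ∉ S) × (∀ i j → i ≢ j → ¬ ConnectedIn G S (r i) (r j))

CutSet : ∀ {n} → Graph n → Subset n → Set
CutSet G S = AtLeastComponents G S 2

-- G is t-tough for a natural number t: t · c(G - S) ≤ |S| for every cut set S.
-- Phrased as: for every cut set S and every k with c(G - S) ≥ k, t · k ≤ |S|
-- (equivalent to t · c(G - S) ≤ |S| since c(G - S) is the largest such k).
Tough : ∀ {n} → ℕ → Graph n → Set
Tough t G = ∀ S → CutSet G S → ∀ k → AtLeastComponents G S k → t * k ≤ ∣ S ∣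

InducedSub : ∀ {m n} → Graph m → Graph n → Set
InducedSub {m} {n} H G =
  Σ (Fin m → Fin n) λ f → Injective _≡_ _≡_ f × (∀ i j → Adj G (f i) (f j) ⇔ Adj H i j)

Free : ∀ {m n} → Graph m → Graph n → Set
Free H G = ¬ InducedSub H G

data K2∪3K1-Adj : Fin 5 → Fin 5 → Set where
  e01 : K2∪3K1-Adj zero (suc zero)
  e10 : K2∪3K1-Adj (suc zero) zero

private
  k-adj? : ∀ u v → Dec (K2∪3K1-Adj u v)
  k-adj? zero zero = Relation.Nullary.no λ ()
  k-adj? zero (suc zero) = Relation.Nullary.yes e01
  k-adj? zero (suc (suc _)) = Relation.Nullary.no λ ()
  k-adj? (suc zero) zero = Relation.Nullary.yes e10
  k-adj? (suc zero) (suc _) = Relation.Nullary.no λ ()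
  k-adj? (suc (suc _)) _ = Relation.Nullary.no λ ()

  k-sym : ∀ {u v} → K2∪3K1-Adj u v → K2∪3K1-Adj v u
  k-sym e01 = e10
  k-sym e10 = e01

  k-irr : ∀ {u} → ¬ K2∪3K1-Adj u u
  k-irr ()

K2∪3K1 : Graph 5
K2∪3K1 = record { Adj = K2∪3K1-Adj ; adj? = k-adj? ; sym = k-sym ; irrefl = k-irr }

-- Hamiltonian: a cyclic ordering σ(0), σ(1), …, σ(m) of all vertices
-- (σ a permutation) with consecutive vertices adjacent and σ(m) adjacent to σ(0).
-- (The empty graph is declared non-hamiltonian; irrelevant here since n ≥ 3.)
Hamiltonian : ∀ {n} → Graph n → Set
Hamiltonian {zero} G = ⊥
Hamiltonian {suc m} G =
  Σ (Permutation′ (suc m)) λ σ →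
    (∀ (i : Fin m) → Adj G (σ ⟨$⟩ʳ inject₁ i) (σ ⟨$⟩ʳ suc i)) ×
    Adj G (σ ⟨$⟩ʳ fromℕ m) (σ ⟨$⟩ʳ zero)

{-# OPTIONS --safe #-}
module Submission where

-- Let C be a longest cycle missing a vertex x, let H be the component of x in G - C, W the set of
-- neighbours of H on C and W⁺ the set of their successors on C. By maximality W⁺ is independent and
-- disjoint from W, so W separates and toughness gives |W⁺| ≥ 6; moreover any two vertices of W⁺ are
-- joined by a path through all of C and part of H. Extend W⁺ to a maximal independent set I. Since G
-- is (K₂ ∪ 3K₁)-free, every vertex outside I is adjacent to all but at most two vertices of I, so any
-- two vertices outside I have two common neighbours p, q in W⁺. The path from p to q then yields a
-- longer cycle as soon as some vertex outside I is off C (close the path through it) or two vertices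
-- outside I are consecutive on C (cross the path over that edge). Hence V - I lies on C with no two
-- consecutive elements, so |V - I| ≤ |I| + 1, whereas toughness demands |V - I| ≥ 3|I|.
--
-- Membership in H is not decided but assumed decidable under a double negation, which is discharged
-- at the end because the existence of a spanning cycle is decidable.

open import Defs
open import Data.Nat using (ℕ; _≤_)

open import Data.Nat using (zero; suc; _+_; _*_; _<_; z≤n; s≤s)
open import Data.Nat.Properties as ℕ using (module ≤-Reasoning)
open import Data.Fin using (Fin; zero; suc; inject₁; inject≤; fromℕ; _≟_)
open import Data.Fin.Patterns using (0F; 1F)
open import Data.Fin.Permutation using (permutation)
open import Data.Fin.Properties using (injective⇒≤; inject≤-injective; any?; sequence)
open import Data.Fin.Subset as Subset using (Subset; ∣_∣; ⁅_⁆; _∪_; inside; outside)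
open import Data.Fin.Subset.Properties using (∉⊥; ∣⊥∣≡0; ∣⁅x⁆∣≡1; x∈⁅x⁆; x∈⁅y⁆⇒x≡y; x∈p∪q⁺; x∈p∪q⁻)
open import Data.List using (List; []; _∷_; [_]; _++_; _∷ʳ_; length; lookup; map; filter; reverse; allFin)
open import Data.List.Properties using (length-map; unfold-reverse; ++-assoc; ++-identityʳ; length-++;
  ∷ʳ-++; ∷-injectiveˡ; ∷-injectiveʳ)
open import Data.List.Membership.Propositional using (_∈_; _∉_)
open import Data.List.Membership.Propositional.Properties
  using (∈-lookup; ∈-filter⁺; ∈-filter⁻; ∈-map⁺; ∈-map⁻; ∈-++⁻; ∈-allFin)
open import Data.List.Membership.Setoid.Properties using (index-injective)
import Data.List.Membership.DecPropositional as DecMembership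
open import Data.List.Relation.Binary.Permutation.Propositional
  using (_↭_; ↭-sym; ↭-trans; ↭⇒↭ₛ; module PermutationReasoning)
open import Data.List.Relation.Binary.Permutation.Propositional.Properties
  using (∈-resp-↭; ↭-length; ↭-reverse; shifts) renaming (++⁺ˡ to ↭-++⁺ˡ; ++⁺ʳ to ↭-++⁺ʳ; ++-comm to ↭-++-comm)
open import Data.List.Relation.Binary.Permutation.Setoid.Properties using (Unique-resp-↭)
open import Data.List.Relation.Unary.All as All using (All; []; _∷_)
open import Data.List.Relation.Unary.All.Properties using (¬Any⇒All¬)
open import Data.List.Relation.Unary.AllPairs as AllPairs using ([]; _∷_)
import Data.List.Relation.Unary.AllPairs.Properties as AllPairs
open import Data.List.Relation.Unary.Any as Any using (here; there)
open import Data.List.Relation.Unary.Any.Properties using (lookup-index)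
open import Data.List.Relation.Unary.Unique.Propositional using (Unique)
import Data.List.Relation.Unary.Unique.Propositional.Properties as Unique
import Data.List.Relation.Unary.Unique.DecPropositional as DecUnique
open import Data.Empty using (⊥)
open import Data.Product using (∃; ∃₂; _×_; _,_; proj₁; proj₂; map₂)
open import Data.Sum as Sum using (_⊎_; inj₁; inj₂; [_,_]′)
open import Data.Vec using ([]; _∷_)
open import Effect.Monad using (RawMonad)
open import Function using (_∘_; id; mk⇔; _⇔_)
open import Level using (0ℓ)
open import Relation.Binary.Construct.Closure.ReflexiveTransitive as Star using (Star; ε; _◅_; _◅◅_)
open import Relation.Binary.PropositionalEquality as ≡ using (_≡_; _≢_; refl; cong; subst)
open import Relation.Nullary using (¬_; Dec; yes; no; ¬?; contradiction)
open import Relation.Nullary.Decidable using (_×-dec_; _⊎-dec_; map′; decidable-stable; ¬¬-excluded-middle)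
open import Relation.Nullary.Negation using (¬¬-Monad)
open import Relation.Unary using (Pred; Decidable)

-- Lists: distinctness, splittings and consecutive entries.

module _ {A : Set} where

  lookup-injective : ∀ {xs : List A} → Unique xs → ∀ {i j} → lookup xs i ≡ lookup xs j → i ≡ j
  lookup-injective {_ ∷ xs} (x∉ ∷ u) {zero}  {zero}  eq = refl
  lookup-injective {_ ∷ xs} (x∉ ∷ u) {zero}  {suc j} eq = contradiction eq (All.lookup x∉ (∈-lookup j))
  lookup-injective {_ ∷ xs} (x∉ ∷ u) {suc i} {zero}  eq = contradiction (≡.sym eq) (All.lookup x∉ (∈-lookup i))
  lookup-injective {_ ∷ xs} (x∉ ∷ u) {suc i} {suc j} eq = cong suc (lookup-injective u eq)

  ∷-unique : ∀ {x} {xs : List A} → x ∉ xs → Unique xs → Unique (x ∷ xs)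
  ∷-unique x∉ u = ¬Any⇒All¬ _ x∉ ∷ u

  unique-↭ : ∀ {xs ys : List A} → xs ↭ ys → Unique xs → Unique ys
  unique-↭ p = Unique-resp-↭ (≡.setoid A) (↭⇒↭ₛ p)

  unique-⊆⇒length≤ : ∀ {xs ys : List A} → Unique xs → (∀ {z} → z ∈ xs → z ∈ ys) → length xs ≤ length ys
  unique-⊆⇒length≤ u sub = injective⇒≤ {f = λ i → Any.index (sub (∈-lookup i))}
    (lookup-injective u ∘ index-injective (≡.setoid A) _ _)

  length-filter-split : ∀ {P : Pred A 0ℓ} (P? : Decidable P) xs →
    length xs ≡ length (filter (¬? ∘ P?) xs) + length (filter P? xs)
  length-filter-split P? [] = refl
  length-filter-split P? (x ∷ xs) with P? x
  ... | yes _ = ≡.trans (cong suc (length-filter-split P? xs)) (≡.sym (ℕ.+-suc _ _))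
  ... | no _  = cong suc (length-filter-split P? xs)

  -- Puts two vertices of a cycle in order: in the left case `x` comes before `y`, with `m` the
  -- stretch between them.
  align-splits : ∀ as cs {bs ds} {x y : A} → as ++ x ∷ bs ≡ cs ++ y ∷ ds → x ≢ y →
    (∃ λ m → cs ≡ as ++ x ∷ m × bs ≡ m ++ y ∷ ds) ⊎ (∃ λ m → as ≡ cs ++ y ∷ m × ds ≡ m ++ x ∷ bs)
  align-splits []       []       refl x≢y = contradiction refl x≢y
  align-splits []       (_ ∷ cs) refl x≢y = inj₁ (cs , refl , refl)
  align-splits (_ ∷ as) []       refl x≢y = inj₂ (as , refl , refl)
  align-splits (a ∷ as) (c ∷ cs) eq   x≢y with refl ← ∷-injectiveˡ eq =
    Sum.map (λ (m , p , q) → m , cong (a ∷_) p , q) (λ (m , p , q) → m , cong (a ∷_) p , q)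
      (align-splits as cs (∷-injectiveʳ eq) x≢y)

  -- Consecutive entries, in this order. For the list of a cycle the closing pair is not counted.
  data Bond (r s : A) : List A → Set where
    here  : ∀ {l} → Bond r s (r ∷ s ∷ l)
    there : ∀ {x l} → Bond r s l → Bond r s (x ∷ l)

  bond-++ˡ : ∀ {r s l} k → Bond r s l → Bond r s (k ++ l)
  bond-++ˡ []      b = b
  bond-++ˡ (_ ∷ k) b = there (bond-++ˡ k b)

  bond-++ʳ : ∀ {r s l} k → Bond r s l → Bond r s (l ++ k)
  bond-++ʳ k here      = here
  bond-++ʳ k (there b) = there (bond-++ʳ k b)

  bond-reverse : ∀ {r s l} → Bond r s l → Bond s r (reverse l)
  bond-reverse {r} {s} (here {l})
    rewrite unfold-reverse r (s ∷ l) | unfold-reverse s l | ∷ʳ-++ (reverse l) s [ r ] = bond-++ˡ (reverse l) here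
  bond-reverse (there {x} {l} b) rewrite unfold-reverse x l = bond-++ʳ [ x ] (bond-reverse b)

  -- The one pair that straddles the junction ends in `y`, which `s ≢ y` excludes.
  bond-++⁻ : ∀ {r s} k {y l} → s ≢ y → Bond r s (k ++ y ∷ l) → Bond r s k ⊎ Bond r s (y ∷ l)
  bond-++⁻ []          s≢y b         = inj₂ b
  bond-++⁻ (x ∷ [])    s≢y here      = contradiction refl s≢y
  bond-++⁻ (x ∷ [])    s≢y (there b) = inj₂ b
  bond-++⁻ (_ ∷ _ ∷ _) s≢y here      = inj₁ here
  bond-++⁻ (_ ∷ y ∷ k) s≢y (there b) = Sum.map₁ there (bond-++⁻ (y ∷ k) s≢y b)

  -- Each entry failing `P`, except possibly the last entry of the list, is followed by one
  -- satisfying `P`; hence the extra one.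
  length-filter-sparse : ∀ {P : Pred A 0ℓ} (P? : Decidable P) l → (∀ {r s} → Bond r s l → P r ⊎ P s) →
    length (filter (¬? ∘ P?) l) ≤ suc (length (filter P? l))
  length-filter-sparse P? []      h = z≤n
  length-filter-sparse P? (x ∷ l) h with P? x
  ... | yes _ = ℕ.m≤n⇒m≤1+n (length-filter-sparse P? l (λ b → h (there b)))
  length-filter-sparse P? (x ∷ [])    h | no ¬px = s≤s z≤n
  length-filter-sparse P? (x ∷ y ∷ l) h | no ¬px with P? y
  ... | yes _  = s≤s (length-filter-sparse P? l (λ b → h (there (there b))))
  ... | no ¬py = contradiction (h here) [ ¬px , ¬py ]′

  -- Pairs (predecessor, element), with p preceding the first element.
  arcs : A → List A → List (A × A)
  arcs p []       = []
  arcs p (x ∷ xs) = (p , x) ∷ arcs x xs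

  map-proj₂-arcs : ∀ p xs → map proj₂ (arcs p xs) ≡ xs
  map-proj₂-arcs p []       = refl
  map-proj₂-arcs p (x ∷ xs) = cong (x ∷_) (map-proj₂-arcs x xs)

-- Counting over `Fin n`, exhaustive search, and lists as subsets.

length≤n : ∀ {n} {xs : List (Fin n)} → Unique xs → length xs ≤ n
length≤n u = injective⇒≤ (lookup-injective u)

n≤length : ∀ {n} {xs : List (Fin n)} → (∀ v → v ∈ xs) → n ≤ length xs
n≤length all∈ = injective⇒≤ {f = λ v → Any.index (all∈ v)} (index-injective (≡.setoid _) _ _)

-- Makes the existence of a spanning cycle decidable, so that it may be proved under a double
-- negation.
∃-length? : ∀ {n} {P : Pred (List (Fin n)) 0ℓ} → Decidable P → ∀ k → Dec (∃ λ l → length l ≡ k × P l)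
∃-length? P? zero = map′ (λ p → [] , refl , p) (λ { ([] , _ , p) → p }) (P? [])
∃-length? P? (suc k) = map′
  (λ (x , l , len , p) → x ∷ l , cong suc len , p)
  (λ { (x ∷ l , len , p) → x , l , ℕ.suc-injective len , p })
  (any? λ x → ∃-length? (P? ∘ (x ∷_)) k)

∣p∪q∣≤∣p∣+∣q∣ : ∀ {n} (p q : Subset n) → ∣ p ∪ q ∣ ≤ ∣ p ∣ + ∣ q ∣
∣p∪q∣≤∣p∣+∣q∣ []            []            = z≤n
∣p∪q∣≤∣p∣+∣q∣ (inside  ∷ p) (inside  ∷ q) =
  s≤s (ℕ.≤-trans (∣p∪q∣≤∣p∣+∣q∣ p q) (ℕ.+-monoʳ-≤ ∣ p ∣ (ℕ.n≤1+n _)))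
∣p∪q∣≤∣p∣+∣q∣ (inside  ∷ p) (outside ∷ q) = s≤s (∣p∪q∣≤∣p∣+∣q∣ p q)
∣p∪q∣≤∣p∣+∣q∣ (outside ∷ p) (inside  ∷ q) =
  ℕ.≤-trans (s≤s (∣p∪q∣≤∣p∣+∣q∣ p q)) (ℕ.≤-reflexive (≡.sym (ℕ.+-suc ∣ p ∣ ∣ q ∣)))
∣p∪q∣≤∣p∣+∣q∣ (outside ∷ p) (outside ∷ q) = ∣p∪q∣≤∣p∣+∣q∣ p q

fromList : ∀ {n} → List (Fin n) → Subset n
fromList []      = Subset.⊥
fromList (x ∷ l) = ⁅ x ⁆ ∪ fromList l

∣fromList∣≤ : ∀ {n} (l : List (Fin n)) → ∣ fromList l ∣ ≤ length l
∣fromList∣≤ {n} []  = ℕ.≤-reflexive (∣⊥∣≡0 n)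
∣fromList∣≤ (x ∷ l) = ℕ.≤-trans (∣p∪q∣≤∣p∣+∣q∣ ⁅ x ⁆ (fromList l))
  (ℕ.+-mono-≤ (ℕ.≤-reflexive (∣⁅x⁆∣≡1 x)) (∣fromList∣≤ l))

∈-fromList⁺ : ∀ {n} {v : Fin n} {l} → v ∈ l → v Subset.∈ fromList l
∈-fromList⁺ (here refl) = x∈p∪q⁺ (inj₁ (x∈⁅x⁆ _))
∈-fromList⁺ (there v∈)  = x∈p∪q⁺ (inj₂ (∈-fromList⁺ v∈))

∈-fromList⁻ : ∀ {n} {v : Fin n} l → v Subset.∈ fromList l → v ∈ l
∈-fromList⁻ []      v∈ = contradiction v∈ ∉⊥
∈-fromList⁻ (x ∷ l) v∈ = [ here ∘ x∈⁅y⁆⇒x≡y x , there ∘ ∈-fromList⁻ l ]′ (x∈p∪q⁻ ⁅ x ⁆ (fromList l) v∈)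

-- Walks, cycles and the arcs of a cycle.

module _ {n : ℕ} (G : Graph n) where

  private
    V : Set
    V = Fin n

  open DecMembership (_≟_ {n}) using (_∈?_)
  open DecUnique (_≟_ {n}) using (unique?)

  -- The list holds all vertices in order, both ends included. Repetitions are allowed; paths carry
  -- a separate `Unique`.
  data Walk : V → V → List V → Set where
    stop : ∀ {a} → Walk a a [ a ]
    step : ∀ {a b c l} → Adj G a b → Walk b c l → Walk a c (a ∷ l)

  walk? : ∀ a b l → Dec (Walk a b l)
  walk? a b [] = no λ ()
  walk? a b (x ∷ []) = map′ (λ { (refl , refl) → stop }) (λ { stop → refl , refl ; (step _ ()) })
    (x ≟ a ×-dec a ≟ b)
  walk? a b (x ∷ l@(_ ∷ _)) = map′ (λ { (refl , _ , e , w) → step e w }) (λ { (step e w) → refl , _ , e , w })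
    (x ≟ a ×-dec any? λ c → adj? G a c ×-dec walk? c b l)

  walk-++ : ∀ {a b c d k l} → Walk a b k → Adj G b c → Walk c d l → Walk a d (k ++ l)
  walk-++ stop       e w = step e w
  walk-++ (step f v) e w = step f (walk-++ v e w)

  walk-reverse : ∀ {a b l} → Walk a b l → Walk b a (reverse l)
  walk-reverse stop = stop
  walk-reverse (step {a} {l = l} e w) rewrite unfold-reverse a l = walk-++ (walk-reverse w) (sym G e) stop

  walk-split : ∀ {a b} x k {y l} → Walk a b (x ∷ k ++ y ∷ l) →
    (∃ λ c → Walk a c (x ∷ k)) × Walk y b (y ∷ l)
  walk-split x []      (step e stop)       = (_ , stop) , stop
  walk-split x []      (step e w@(step _ _)) = (_ , stop) , w
  walk-split x (z ∷ k) (step e w) with (c , u) , v ← walk-split z k w = (c , step e u) , v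

  walk-cut : ∀ {a b r s l} → Walk a b l → Bond r s l →
    ∃₂ λ k m → l ≡ k ++ m × Walk a r k × Walk s b m
  walk-cut (step e stop)         here = _ , _ , refl , stop , stop
  walk-cut (step e w@(step _ _)) here = _ , _ , refl , stop , w
  walk-cut (step e w) (there b) with k , m , refl , u , v ← walk-cut w b = _ ∷ k , m , refl , step e u , v

  walk-start-∈ : ∀ {a b l} → Walk a b l → a ∈ l
  walk-start-∈ stop       = here refl
  walk-start-∈ (step _ _) = here refl

  walk-end-∈ : ∀ {a b l} → Walk a b l → b ∈ l
  walk-end-∈ stop       = here refl
  walk-end-∈ (step _ w) = there (walk-end-∈ w)

  walk-nonempty : ∀ {a b l} → Walk a b l → 0 < length l
  walk-nonempty stop       = s≤s z≤n
  walk-nonempty (step _ _) = s≤s z≤n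

  -- Two adjacent vertices already form a cycle in this sense; longer ones are genuine.
  record Cycle (C : List V) : Set where
    constructor cycle
    field
      {start end} : V
      walk    : Walk start end C
      closing : Adj G end start
      unique  : Unique C

  cycle? : ∀ C → Dec (Cycle C)
  cycle? C = map′ (λ (_ , _ , w , e , u) → cycle w e u) (λ (cycle w e u) → _ , _ , w , e , u)
    (any? λ a → any? λ b → walk? a b C ×-dec adj? G b a ×-dec unique? C)

  -- Cut `P` between `r` and `s`: the cycle runs from `a` to `r`, jumps to `b`, follows `P`
  -- backwards to `s` and returns to `a`.
  crossing : ∀ {a b r s P} → Walk a b P → Unique P → Bond r s P → Adj G r b → Adj G s a →
    ∃ λ D → Cycle D × length D ≡ length P
  crossing w u bond rb sa with k , m , refl , v , v′ ← walk-cut w bond =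
    k ++ reverse m
    , cycle (walk-++ v rb (walk-reverse v′)) sa (unique-↭ (↭-sym perm) u)
    , ↭-length perm
    where
    perm : k ++ reverse m ↭ k ++ m
    perm = ↭-++⁺ˡ k (↭-reverse m)

  -- w′ follows w on the cycle C; rotated is C traversed from w′ to w.
  record Arc (C : List V) (w w′ : V) : Set where
    constructor arc
    field
      {before after} : List V
      splits  : before ++ w′ ∷ after ≡ C
      rotated : Walk w′ w (w′ ∷ after ++ before)

  arc-source-∈ : ∀ {C w w′} → Arc C w w′ → w ∈ C
  arc-source-∈ {w′ = w′} (arc {A} {B} refl rot) = ∈-resp-↭ (↭-++-comm (w′ ∷ B) A) (walk-end-∈ rot)

  arcs⇒Arc : ∀ {C} (c : Cycle C) → ∀ {w w′} → (w , w′) ∈ arcs (Cycle.end c) C → Arc C w w′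
  arcs⇒Arc (cycle {a} {b} walk closing _) = first walk
    where
    -- `A` is the part of the cycle already passed; the rotated walk follows the rest, then the
    -- closing edge, then `A`.
    from : ∀ {p p′} A {B} → Walk a p A → Adj G p p′ → Walk p′ b B →
      ∀ {w w′} → (w , w′) ∈ arcs p B → Arc (A ++ B) w w′
    from A v e u@stop       (here refl) = arc refl (walk-++ u closing v)
    from A v e u@(step _ _) (here refl) = arc refl (walk-++ u closing v)
    from A v e (step {p} {l = l} f u) (there i) =
      subst (λ C → Arc C _ _) (∷ʳ-++ A p l) (from (A ∷ʳ p) (walk-++ v e stop) f u i)

    first : ∀ {C} → Walk a b C → ∀ {w w′} → (w , w′) ∈ arcs b C → Arc C w w′
    first stop            (here refl) = arc {before = []} refl stop
    first (step {l = l} e u) (here refl) = arc {before = []} refl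
      (subst (Walk a b) (≡.sym (++-identityʳ (a ∷ l))) (step e u))
    first (step e u)      (there i)   = from [ a ] stop e u i

  ∈⇒arcs : ∀ {a b p l v} → Walk a b l → v ∈ l → v ≡ b ⊎ ∃ λ v′ → (v , v′) ∈ arcs p l
  ∈⇒arcs stop       (here refl) = inj₁ refl
  ∈⇒arcs (step e stop) (here refl) = inj₂ (_ , there (here refl))
  ∈⇒arcs (step e (step _ _)) (here refl) = inj₂ (_ , there (here refl))
  ∈⇒arcs (step e w) (there v∈)  = Sum.map₂ (map₂ there) (∈⇒arcs w v∈)

  arcs-total : ∀ {C} (c : Cycle C) {v} → v ∈ C → ∃ λ v′ → (v , v′) ∈ arcs (Cycle.end c) C
  arcs-total (cycle walk _ _) v∈ with ∈⇒arcs walk v∈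
  ... | inj₂ i = i
  -- The successor of the last vertex is the first one, recorded in the first pair of `arcs`.
  ... | inj₁ refl = first walk
    where
    first : ∀ {a b p l} → Walk a b l → ∃ λ v′ → (p , v′) ∈ arcs p l
    first stop       = _ , here refl
    first (step _ _) = _ , here refl

  arcs-∈ : ∀ {C} (c : Cycle C) {w w′} → (w , w′) ∈ arcs (Cycle.end c) C → w′ ∈ C
  arcs-∈ {C} c i = subst (_ ∈_) (map-proj₂-arcs _ C) (∈-map⁺ proj₂ i)

  -- Paths off the cycle, and detours through all of it.

  Off : List V → V → V → Set
  Off C u v = u ∉ C × v ∉ C × Adj G u v

  off-end : ∀ {C u v} → u ∉ C → Star (Off C) u v → v ∉ C
  off-end u∉ ε = u∉
  off-end _  ((_ , v∉ , _) ◅ s) = off-end v∉ s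

  walk-from : ∀ {a b l u} → Walk a b l → Unique l → u ∈ l →
    ∃ λ k → Walk u b k × Unique k × (∀ {z} → z ∈ k → z ∈ l)
  walk-from stop       uq (here refl) = _ , stop , uq , id
  walk-from (step e w) uq (here refl) = _ , step e w , uq , id
  walk-from (step e w) (_ ∷ uq) (there u∈) with k , v , uq′ , sub ← walk-from w uq u∈ =
    k , v , uq′ , there ∘ sub

  -- Loop erasure: if the new first vertex already lies on the path, only the part from that
  -- occurrence on is kept.
  star⇒walk : ∀ {C u v} → Star (Off C) u v →
    ∃ λ l → Walk u v l × Unique l × (∀ {z} → z ∈ l → Star (Off C) u z)
  star⇒walk ε = _ , stop , [] ∷ [] , λ { (here refl) → ε }
  star⇒walk {u = u} (o ◅ s) with l , w , uq , sub ← star⇒walk s | u ∈? l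
  ... | no u∉ = u ∷ l , step (proj₂ (proj₂ o)) w , ∷-unique u∉ uq
              , λ { (here refl) → ε ; (there z∈) → o ◅ sub z∈ }
  ... | yes u∈ with k , w′ , uq′ , sub′ ← walk-from w uq u∈ = k , w′ , uq′ , λ z∈ → o ◅ sub (sub′ z∈)

  -- A detour breaks `C` just before `p` and just before `q`. `bonds` says that no other consecutive
  -- pair is lost, though its direction may change; this is what makes crossing possible.
  record Detour (C H : List V) (p q : V) : Set where
    constructor detour
    field
      {path}  : List V
      walk    : Walk p q path
      perm    : path ↭ H ++ C
      bonds   : ∀ {r s} → Bond r s C → s ≢ p → s ≢ q → Bond r s path ⊎ Bond s r path

  detour-reverse : ∀ {C H p q} → Detour C H p q → Detour C H q p
  detour-reverse (detour {P} w p b) = detour (walk-reverse w) (↭-trans (↭-reverse P) p)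
    (λ bd s≢q s≢p → Sum.swap (Sum.map bond-reverse bond-reverse (b bd s≢p s≢q)))

  -- The cycle falls into arcs p … w₂ and q … w₁; the detour runs p … w₂ h₂ … h₁ w₁ … q, the last arc backwards.
  arcs⇒detour : ∀ {C H w₁ w₂ h₁ h₂ p q} → Arc C w₁ p → Arc C w₂ q → p ≢ q →
    Walk h₁ h₂ H → Adj G h₁ w₁ → Adj G h₂ w₂ → Detour C H p q
  arcs⇒detour {C} {H} (arc {A₁} {B₁} s₁ r₁) (arc {A₂} {B₂} s₂ r₂) p≢q h e₁ e₂ =
    [ (λ (m , eA , eB) → in-order m s₁ r₁ r₂ eA eB h e₁ e₂)
    -- If `q` comes first, the roles of the two arcs are exchanged, and both the path in `H` and the
    -- detour are reversed.
    , (λ (m , eA , eB) → detour-reverse (flip-H (in-order m s₂ r₂ r₁ eA eB (walk-reverse h) e₂ e₁)))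
    ]′ (align-splits A₁ A₂ (≡.trans s₁ (≡.sym s₂)) p≢q)
    where
    flip-H : ∀ {H p q} → Detour C (reverse H) p q → Detour C H p q
    flip-H {H} (detour w π b) = detour w (↭-trans π (↭-++⁺ʳ C (↭-reverse H))) b

    in-order : ∀ {A₁ A₂ B₁ B₂ H w₁ w₂ h₁ h₂ p q} m → A₁ ++ p ∷ B₁ ≡ C →
      Walk p w₁ (p ∷ B₁ ++ A₁) → Walk q w₂ (q ∷ B₂ ++ A₂) →
      A₂ ≡ A₁ ++ p ∷ m → B₁ ≡ m ++ q ∷ B₂ →
      Walk h₁ h₂ H → Adj G h₁ w₁ → Adj G h₂ w₂ → Detour C H p q
    in-order {A₁} {_} {_} {B₂} {H} {p = p} {q} m refl r₁ r₂ refl refl h e₁ e₂ =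
      detour (walk-++ seg₁ (sym G e₂) (walk-++ (walk-reverse h) e₁ (walk-reverse seg₂))) perm bonds
      where
      X = p ∷ m
      Z = q ∷ B₂ ++ A₁

      -- From `q` the cycle reads `q`, `B₂`, `A₁`, `p`, `m` and ends at `w₂`; cutting before `p`
      -- leaves the walk from `p` to `w₂`.
      seg₁ : Walk p _ X
      seg₁ = proj₂ (walk-split q (B₂ ++ A₁)
        (subst (Walk q _) (cong (q ∷_) (≡.sym (++-assoc B₂ A₁ X))) r₂))

      seg₂ : Walk q _ Z
      seg₂ = proj₂ (walk-split p m (subst (Walk p _) (cong (p ∷_) (++-assoc m (q ∷ B₂) A₁)) r₁))

      perm : X ++ reverse H ++ reverse Z ↭ H ++ A₁ ++ X ++ q ∷ B₂
      perm = begin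
        X ++ reverse H ++ reverse Z ↭⟨ shifts X (reverse H) ⟩
        reverse H ++ X ++ reverse Z ↭⟨ ↭-++⁺ʳ _ (↭-reverse H) ⟩
        H ++ X ++ reverse Z         ↭⟨ ↭-++⁺ˡ H (↭-++⁺ˡ X (↭-reverse Z)) ⟩
        H ++ X ++ (q ∷ B₂) ++ A₁    ≡⟨ cong (H ++_) (++-assoc X (q ∷ B₂) A₁) ⟨
        H ++ (X ++ q ∷ B₂) ++ A₁    ↭⟨ ↭-++⁺ˡ H (↭-++-comm (X ++ q ∷ B₂) A₁) ⟩
        H ++ A₁ ++ X ++ q ∷ B₂      ∎
        where open PermutationReasoning

      to-Z : ∀ {r s} → Bond r s Z → Bond s r (X ++ reverse H ++ reverse Z)
      to-Z b = bond-++ˡ X (bond-++ˡ (reverse H) (bond-reverse b))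

      bonds : ∀ {r s} → Bond r s (A₁ ++ X ++ q ∷ B₂) → s ≢ p → s ≢ q →
        Bond r s (X ++ reverse H ++ reverse Z) ⊎ Bond s r (X ++ reverse H ++ reverse Z)
      -- `C` is `A₁`, then `X`, then `q ∷ B₂`. The detour runs through `X` forwards and through the
      -- other two pieces, joined as `Z`, backwards.
      bonds b s≢p s≢q with bond-++⁻ A₁ s≢p b
      ... | inj₁ b₁ = inj₂ (to-Z (bond-++ˡ (q ∷ B₂) b₁))
      ... | inj₂ b₂ with bond-++⁻ X s≢q b₂
      ...   | inj₁ b₃ = inj₁ (bond-++ʳ _ b₃)
      ...   | inj₂ b₃ = inj₂ (to-Z (bond-++ʳ A₁ b₃))

  -- Independent sets, the forbidden subgraph and toughness.

  Independent : List V → Set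
  Independent I = ∀ {u v} → u ∈ I → v ∈ I → ¬ Adj G u v

  -- Greedy: a vertex of `vs` joins the set if it has no neighbour there yet. With all vertices in
  -- `vs`, the last clause is maximality of `J`.
  extend-independent : ∀ vs {I} → Unique I → Independent I → ∃ λ J →
    (∀ {z} → z ∈ I → z ∈ J) × Unique J × Independent J ×
    (∀ {v} → v ∈ vs → v ∉ J → ∃ λ u → u ∈ J × Adj G v u)
  extend-independent []       uI iI = _ , id , uI , iI , λ ()
  extend-independent (x ∷ vs) uI iI with extend-independent vs uI iI
  ... | J , sub , uJ , iJ , dom with x ∈? J | Any.any? (adj? G x) J
  ... | yes x∈ | _ = J , sub , uJ , iJ , λ
    { (here refl) v∉ → contradiction x∈ v∉ ; (there v∈) v∉ → dom v∈ v∉ }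
  ... | no _   | yes a = J , sub , uJ , iJ , λ
    { (here refl) _ → Any.lookup a , ∈-lookup (Any.index a) , lookup-index a ; (there v∈) v∉ → dom v∈ v∉ }
  ... | no x∉  | no ¬a = x ∷ J , there ∘ sub , ∷-unique x∉ uJ , indep , λ
    { (here refl) v∉ → contradiction (here refl) v∉
    ; (there v∈) v∉ → map₂ (λ (u∈ , e) → there u∈ , e) (dom v∈ (v∉ ∘ there)) }
    where
    isolated : ∀ {u} → u ∈ J → ¬ Adj G x u
    isolated u∈ e = ¬a (Any.map (λ { refl → e }) u∈)
    indep : Independent (x ∷ J)
    indep (here refl) (here refl) = irrefl G
    indep (here refl) (there v∈)  = isolated v∈
    indep (there u∈)  (here refl) = isolated u∈ ∘ sym G
    indep (there u∈)  (there v∈)  = iJ u∈ v∈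

  -- The edge is `v` with `g zero`. No `g i` equals `v`, because `v` is adjacent to `g zero` and no
  -- `g i` is.
  independent⇒induced : ∀ {v} (g : Fin 4 → V) → (∀ {i j} → g i ≡ g j → i ≡ j) →
    (∀ i j → ¬ Adj G (g i) (g j)) → Adj G v (g zero) → (∀ i → ¬ Adj G v (g (suc i))) → InducedSub K2∪3K1 G
  independent⇒induced {v} g inj indep e none = f , f-injective , f-adj
    where
    v≢g : ∀ i → v ≢ g i
    v≢g i refl = indep i zero e

    f : Fin 5 → V
    f zero    = v
    f (suc i) = g i

    f-injective : ∀ {i j} → f i ≡ f j → i ≡ j
    f-injective {zero}  {zero}  _  = refl
    f-injective {zero}  {suc j} eq = contradiction eq (v≢g j)
    f-injective {suc i} {zero}  eq = contradiction (≡.sym eq) (v≢g i)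
    f-injective {suc i} {suc j} eq = cong suc (inj eq)

    f-adj : ∀ i j → Adj G (f i) (f j) ⇔ K2∪3K1-Adj i j
    f-adj zero          zero          = mk⇔ (λ a → contradiction a (irrefl G)) λ ()
    f-adj zero          (suc zero)    = mk⇔ (λ _ → e01) (λ _ → e)
    f-adj zero          (suc (suc j)) = mk⇔ (λ a → contradiction a (none j)) λ ()
    f-adj (suc zero)    zero          = mk⇔ (λ _ → e10) (λ _ → sym G e)
    f-adj (suc (suc i)) zero          = mk⇔ (λ a → contradiction (sym G a) (none i)) λ ()
    f-adj (suc i)       (suc j)       = mk⇔ (λ a → contradiction a (indep i j)) λ ()

  -- Three non-neighbours of `v` in `I` would form an induced K₂ ∪ 3K₁ with the edge `vu`.
  free⇒adjacent-to-most : Free K2∪3K1 G → ∀ {I u v} → Independent I → u ∈ I → Adj G v u →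
    ∀ {ws} → Unique ws → (∀ {z} → z ∈ ws → z ∈ I) → length ws ≤ 2 + length (filter (adj? G v) ws)
  free⇒adjacent-to-most free {I} {u} {v} indep u∈ vu {ws} uq sub = begin
    length ws                                                             ≡⟨ length-filter-split (adj? G v) ws ⟩
    length (filter (¬? ∘ adj? G v) ws) + length (filter (adj? G v) ws)
      ≤⟨ ℕ.+-monoˡ-≤ _ (few _ (Unique.filter⁺ (¬? ∘ adj? G v) uq) (∈-filter⁻ (¬? ∘ adj? G v) {xs = ws})) ⟩
    2 + length (filter (adj? G v) ws)                                     ∎
    where
    open ≤-Reasoning
    few : ∀ xs → Unique xs → (∀ {z} → z ∈ xs → z ∈ ws × ¬ Adj G v z) → length xs ≤ 2
    few []          _ _ = z≤n
    few (_ ∷ [])    _ _ = s≤s z≤n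
    few (_ ∷ _ ∷ []) _ _ = s≤s (s≤s z≤n)
    few xs@(a ∷ b ∷ c ∷ _) ((a≢b ∷ a≢c ∷ _) ∷ (b≢c ∷ _) ∷ _) in-ws =
      contradiction (independent⇒induced (lookup four) (lookup-injective four!)
        (λ i j → indep (four⊆I (∈-lookup i)) (four⊆I (∈-lookup j))) vu
        (λ i → proj₂ (in-ws (three⊆ (∈-lookup i))))) free
      where
      three = a ∷ b ∷ c ∷ []
      four = u ∷ three
      three⊆ : ∀ {z} → z ∈ three → z ∈ xs
      three⊆ (here p) = here p
      three⊆ (there (here p)) = there (here p)
      three⊆ (there (there (here p))) = there (there (here p))
      four⊆I : ∀ {z} → z ∈ four → z ∈ I
      four⊆I (here refl) = u∈
      four⊆I (there z∈) = sub (proj₁ (in-ws (three⊆ z∈)))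
      four! : Unique four
      four! = ∷-unique (λ u∈3 → proj₂ (in-ws (three⊆ u∈3)) vu)
        ((a≢b ∷ a≢c ∷ []) ∷ (b≢c ∷ []) ∷ [] ∷ [])

  -- Toughness for lists: `rs` represents distinct components after deleting `ss`. Repetitions in
  -- `ss` only weaken the bound.
  tough-separation : ∀ t → Tough t G → ∀ ss rs → 2 ≤ length rs → (∀ {z} → z ∈ rs → z ∉ ss) →
    (∀ i j → i ≢ j → ¬ ConnectedIn G (fromList ss) (lookup rs i) (lookup rs j)) → t * length rs ≤ length ss
  tough-separation t tough ss rs 2≤ avoids sep =
    ℕ.≤-trans (tough (fromList ss) cut (length rs) (lookup rs , out , sep)) (∣fromList∣≤ ss)
    where
    out : ∀ i → lookup rs i Subset.∉ fromList ss
    out i = avoids (∈-lookup i) ∘ ∈-fromList⁻ ss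
    cut : CutSet G (fromList ss)
    cut = (λ i → lookup rs (inject≤ i 2≤)) , (λ i → out _) ,
      λ i j i≢j → sep _ _ (i≢j ∘ inject≤-injective 2≤ 2≤ i j)

  -- Without edges the empty set would separate two vertices, and toughness would give 6 ≤ 0.
  hasEdge : Tough 3 G → 3 ≤ n → ∃₂ (Adj G)
  hasEdge tough (s≤s (s≤s _)) with any? (λ u → any? (adj? G u))
  ... | yes e = e
  ... | no ¬e = contradiction
    (tough-separation 3 tough [] (0F ∷ 1F ∷ []) ℕ.≤-refl (λ _ ()) apart) λ ()
    where
    stuck : ∀ {u v} → ConnectedIn G (fromList []) u v → u ≡ v
    stuck (_ , _ , ε) = refl
    stuck (_ , _ , ((_ , _ , e) ◅ _)) = contradiction (_ , _ , e) ¬e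
    apart : ∀ i j → i ≢ j → ¬ ConnectedIn G (fromList []) (lookup (0F ∷ 1F ∷ []) i) (lookup (0F ∷ 1F ∷ []) j)
    apart i j i≢j c = i≢j (lookup-injective (((λ ()) ∷ []) ∷ [] ∷ []) (stuck c))

  -- A longest cycle missing a vertex, and the component of that vertex.

  module LongestCycle (tough : Tough 3 G) (free : Free K2∪3K1 G) {C : List V} (c : Cycle C)
    (longest : ∀ {D} → Cycle D → length D ≤ length C) {x : V} (x∉C : x ∉ C) where

    open Cycle c using () renaming (walk to C-walk; unique to C-unique; end to C-end)

    InH : V → Set
    InH = Star (Off C) x

    NearH : V → Set
    NearH v = ∃ λ h → InH h × Adj G h v

    H-joined : ∀ {h h′} → InH h → InH h′ → Star (Off C) h h′
    H-joined s s′ = Star.reverse (λ (u∉ , v∉ , e) → v∉ , u∉ , sym G e) s ◅◅ s′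

    -- The ends `from` and `to` may coincide, so `w` and `w′` may be attached to the same vertex of
    -- H.
    record HPath (w w′ : V) : Set where
      constructor hpath
      field
        {from to} : V
        {path} : List V
        walk   : Walk from to path
        first  : Adj G from w
        last   : Adj G to w′
        unique : Unique path
        inH    : ∀ {z} → z ∈ path → InH z

    near⇒hpath : ∀ {w w′} → NearH w → NearH w′ → HPath w w′
    near⇒hpath (h , s , e) (h′ , s′ , e′) with l , w , uq , sub ← star⇒walk (H-joined s s′) =
      hpath w e e′ uq (λ z∈ → s ◅◅ sub z∈)

    hpath-++-unique : ∀ {w w′} (h : HPath w w′) → Unique (HPath.path h ++ C)
    hpath-++-unique (hpath _ _ _ uq inH) = Unique.++⁺ uq C-unique (λ (z∈ , z∈C) → off-end x∉C (inH z∈) z∈C)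

    too-long : ∀ {D w w′} (h : HPath w w′) → Cycle D → ¬ length (HPath.path h ++ C) ≤ length D
    too-long {D} (hpath {path = Q} w _ _ _ _) d le = ℕ.<-irrefl refl (begin-strict
      length C            <⟨ ℕ.m<n+m (length C) (walk-nonempty w) ⟩
      length Q + length C ≡⟨ length-++ Q ⟨
      length (Q ++ C)     ≤⟨ le ⟩
      length D            ≤⟨ longest d ⟩
      length C            ∎)
      where open ≤-Reasoning

    -- Otherwise the edge from `w` to `w′` could be replaced by a path through H, which adds at
    -- least one vertex to the cycle.
    successor-not-near : ∀ {w w′} → Arc C w w′ → NearH w → ¬ NearH w′
    successor-not-near {w} {w′} (arc {A} {B} refl rot) near near′ = too-long h
      (cycle (walk-++ rot (sym G (HPath.first h)) (HPath.walk h)) (HPath.last h)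
        (unique-↭ (↭-sym perm) (hpath-++-unique h)))
      (ℕ.≤-reflexive (≡.sym (↭-length perm)))
      where
      open PermutationReasoning
      h = near⇒hpath near near′
      Q = HPath.path h
      perm : (w′ ∷ B ++ A) ++ Q ↭ Q ++ A ++ w′ ∷ B
      perm = begin
        (w′ ∷ B ++ A) ++ Q ↭⟨ ↭-++-comm (w′ ∷ B ++ A) Q ⟩
        Q ++ (w′ ∷ B) ++ A ↭⟨ ↭-++⁺ˡ Q (↭-++-comm (w′ ∷ B) A) ⟩
        Q ++ A ++ w′ ∷ B   ∎

    -- The neighbours of H on the cycle and their successors.

    module Neighbourhood (near? : ∀ v → Dec (NearH v)) where

      -- Storing arcs makes `W` and `W⁺` equally long and gives each vertex of `W⁺` its predecessor.
      W-arcs : List (V × V)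
      W-arcs = filter (near? ∘ proj₁) (arcs C-end C)

      W W⁺ : List V
      W  = map proj₁ W-arcs
      W⁺ = map proj₂ W-arcs

      W-arc : ∀ {p} → p ∈ W-arcs → Arc C (proj₁ p) (proj₂ p) × NearH (proj₁ p) × proj₂ p ∈ C
      W-arc p∈ with p∈′ , near ← ∈-filter⁻ (near? ∘ proj₁) {xs = arcs C-end C} p∈ =
        arcs⇒Arc c p∈′ , near , arcs-∈ c p∈′

      W⁺-pred : ∀ {p} → p ∈ W⁺ → ∃ λ w → Arc C w p × NearH w × p ∈ C
      W⁺-pred p∈ with _ , p∈′ , refl ← ∈-map⁻ proj₂ p∈ = _ , W-arc p∈′

      ∈-W : ∀ {v} → v ∈ C → NearH v → v ∈ W
      ∈-W v∈ near = ∈-map⁺ proj₁ (∈-filter⁺ (near? ∘ proj₁) (proj₂ (arcs-total c v∈)) near)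

      W⇒near : ∀ {v} → v ∈ W → NearH v
      W⇒near v∈ with _ , p∈ , refl ← ∈-map⁻ proj₁ v∈ = proj₁ (proj₂ (W-arc p∈))

      W⁺-unique : Unique W⁺
      W⁺-unique = AllPairs.map⁺ (AllPairs.filter⁺ (near? ∘ proj₁)
        (AllPairs.map⁻ (subst Unique (≡.sym (map-proj₂-arcs C-end C)) C-unique)))

      W⁺-not-H : ∀ {p} → p ∈ W⁺ → ∀ {y} → InH y → ¬ Adj G y p
      W⁺-not-H p∈ s e with _ , a , near , _ ← W⁺-pred p∈ = successor-not-near a near (_ , s , e)

      -- A successor of a vertex of `W` will do, or any vertex of `C` if `W` is empty.
      far : ∃ λ v → v ∈ C × v ∉ W
      far with W-arcs in eq
      ... | [] = _ , walk-start-∈ C-walk , λ ()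
      ... | (w , w′) ∷ _ with a , near , w′∈ ← W-arc (subst ((w , w′) ∈_) (≡.sym eq) (here refl)) =
        w′ , w′∈ , λ w′∈W → successor-not-near a near (W⇒near (subst (λ l → w′ ∈ map proj₁ l) (≡.sym eq) w′∈W))

      x∉W : x ∉ W
      x∉W x∈ with _ , p∈ , refl ← ∈-map⁻ proj₁ x∈ = x∉C (arc-source-∈ (proj₁ (W-arc p∈)))

      -- A walk can leave H only through a vertex of `C` adjacent to H, and all of these are
      -- deleted.
      closed : ∀ {u v} → InH u → Star (AdjMinus G (fromList W)) u v → InH v
      closed s ε = s
      closed {u} s (_◅_ {j = v} (_ , v∉W , e) r) with v ∈? C
      ... | yes v∈ = contradiction (∈-fromList⁺ (∈-W v∈ (u , s , e))) v∉W
      ... | no v∉  = closed (s ◅◅ ((off-end x∉C s , v∉ , e) ◅ ε)) r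

      -- `W` separates `x` from the vertex given by `far`, so it has at least 3 · 2 vertices.
      6≤∣W⁺∣ : 6 ≤ length W⁺
      6≤∣W⁺∣ with f , f∈C , f∉W ← far = begin
        6             ≤⟨ tough-separation 3 tough W (x ∷ f ∷ []) ℕ.≤-refl
                          (λ { (here refl) → x∉W ; (there (here refl)) → f∉W }) apart ⟩
        length W      ≡⟨ length-map proj₁ W-arcs ⟩
        length W-arcs ≡⟨ length-map proj₂ W-arcs ⟨
        length W⁺     ∎
        where
        open ≤-Reasoning
        xf : ¬ Star (AdjMinus G (fromList W)) x f
        xf r = off-end x∉C (closed ε r) f∈C
        apart : ∀ i j → i ≢ j → ¬ ConnectedIn G (fromList W) (lookup (x ∷ f ∷ []) i) (lookup (x ∷ f ∷ []) j)
        apart 0F 0F i≢j _ = i≢j refl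
        apart 0F 1F _ (_ , _ , r) = xf r
        apart 1F 0F _ (_ , _ , r) = xf (Star.reverse (λ (u∉ , v∉ , e) → v∉ , u∉ , sym G e) r)
        apart 1F 1F i≢j _ = i≢j refl

      record LongPath (p q : V) : Set where
        constructor longPath
        field
          {path} : List V
          walk   : Walk p q path
          unique : Unique path
          longer : length C < length path
          within : ∀ {z} → z ∈ path → InH z ⊎ z ∈ C
          bonds  : ∀ {r s} → Bond r s C → s ≢ p → s ≢ q → Bond r s path ⊎ Bond s r path

      W⁺-longPath : ∀ {p q} → p ∈ W⁺ → q ∈ W⁺ → p ≢ q → LongPath p q
      W⁺-longPath {p} {q} p∈ q∈ p≢q = join (W⁺-pred p∈) (W⁺-pred q∈)
        where
        along : ∀ {w w′} (h : HPath w w′) → Detour C (HPath.path h) p q → LongPath p q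
        along h@(hpath {path = Q} hw _ _ _ inH) (detour {P} w π b) =
          longPath w (unique-↭ (↭-sym π) (hpath-++-unique h)) longer (Sum.map₁ inH ∘ ∈-++⁻ Q ∘ ∈-resp-↭ π) b
          where
          open ≤-Reasoning
          longer : length C < length P
          longer = begin-strict
            length C            <⟨ ℕ.m<n+m (length C) (walk-nonempty hw) ⟩
            length Q + length C ≡⟨ length-++ Q ⟨
            length (Q ++ C)     ≡⟨ ↭-length π ⟨
            length P            ∎

        join : (∃ λ w → Arc C w p × NearH w × p ∈ C) → (∃ λ w → Arc C w q × NearH w × q ∈ C) → LongPath p q
        join (_ , a , near , _) (_ , a′ , near′ , _) =
          let h = near⇒hpath near near′
          in along h (arcs⇒detour a a′ p≢q (HPath.walk h) (HPath.first h) (HPath.last h))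

      -- An edge between `p` and `q` would close their long path to a cycle longer than `C`.
      W⁺-independent : Independent W⁺
      W⁺-independent {p} {q} p∈ q∈ e =
        ℕ.<⇒≱ (LongPath.longer P) (longest (cycle (LongPath.walk P) (sym G e) (LongPath.unique P)))
        where
        P : LongPath p q
        P = W⁺-longPath p∈ q∈ (λ { refl → irrefl G e })

      -- A maximal independent set containing `W⁺`, and the final count.

      module Dominating {I : List V} (W⁺⊆I : ∀ {z} → z ∈ W⁺ → z ∈ I) (I! : Unique I)
        (I-indep : Independent I) (dominated : ∀ {v} → v ∈ allFin n → v ∉ I → ∃ λ u → u ∈ I × Adj G v u) where

        most : ∀ {v} → v ∉ I → ∀ {ws} → Unique ws → (∀ {z} → z ∈ ws → z ∈ W⁺) →
          length ws ≤ 2 + length (filter (adj? G v) ws)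
        most v∉ ws! sub with u , u∈ , e ← dominated (∈-allFin _) v∉ =
          free⇒adjacent-to-most free I-indep u∈ e ws! (W⁺⊆I ∘ sub)

        -- Of at least six vertices in `W⁺`, `r` misses at most two and `s` at most two of the
        -- remaining ones. The case `r` = `s` is included.
        two-common : ∀ {r s} → r ∉ I → s ∉ I → ∃₂ λ p q → p ≢ q ×
          (p ∈ W⁺ × Adj G r p × Adj G s p) × (q ∈ W⁺ × Adj G r q × Adj G s q)
        two-common {r} {s} r∉ s∉ = pick both! both-spec
          (ℕ.+-cancelˡ-≤ 4 2 _ (ℕ.≤-trans 6≤∣W⁺∣ (ℕ.≤-trans (most r∉ W⁺-unique id)
            (ℕ.+-monoʳ-≤ 2 (most s∉ (Unique.filter⁺ (adj? G r) W⁺-unique) (proj₁ ∘ ∈-filter⁻ (adj? G r) {xs = W⁺}))))))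
          where
          both = filter (adj? G s) (filter (adj? G r) W⁺)

          both! : Unique both
          both! = Unique.filter⁺ (adj? G s) (Unique.filter⁺ (adj? G r) W⁺-unique)

          both-spec : ∀ {p} → p ∈ both → p ∈ W⁺ × Adj G r p × Adj G s p
          both-spec p∈
            with p∈′ , sp ← ∈-filter⁻ (adj? G s) {xs = filter (adj? G r) W⁺} p∈
            with p∈″ , rp ← ∈-filter⁻ (adj? G r) {xs = W⁺} p∈′ =
            p∈″ , rp , sp

          pick : ∀ {l} {P : Pred V 0ℓ} → Unique l → (∀ {p} → p ∈ l → P p) → 2 ≤ length l →
            ∃₂ λ p q → p ≢ q × P p × P q
          pick {_ ∷ []}    _ _ (s≤s ())
          pick {p ∷ q ∷ _} ((p≢q ∷ _) ∷ _) h _ = p , q , p≢q , h (here refl) , h (there (here refl))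

        -- `y` is not on the path: it is off `C`, and it is not in H because no vertex of H is
        -- adjacent to `p`.
        LongPath-absorbs : ∀ {y p q} → p ∈ W⁺ → LongPath p q → Adj G y p → Adj G y q → y ∉ C → ⊥
        LongPath-absorbs {y} p∈ (longPath {P} w u l within _) yp yq y∉C =
          ℕ.<⇒≱ (ℕ.m<n⇒m<1+n l) (longest (cycle (step yp w) (sym G yq) (∷-unique y∉P u)))
          where
          y∉P : y ∉ P
          y∉P y∈ = [ (λ s → W⁺-not-H p∈ s yp) , y∉C ]′ (within y∈)

        outside⊆C : ∀ {y} → y ∉ I → y ∈ C
        outside⊆C {y} y∉I = decidable-stable (y ∈? C) (absorb (two-common y∉I y∉I))
          where
          absorb : (∃₂ λ p q → p ≢ q × (p ∈ W⁺ × Adj G y p × Adj G y p) × (q ∈ W⁺ × Adj G y q × Adj G y q)) →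
            ¬ y ∉ C
          absorb (_ , _ , p≢q , (p∈ , yp , _) , (q∈ , yq , _)) =
            LongPath-absorbs p∈ (W⁺-longPath p∈ q∈ p≢q) yp yq

        LongPath-crossed : ∀ {r s p q} → LongPath p q → Bond r s C → s ≢ p → s ≢ q →
          Adj G r p → Adj G s p → Adj G r q → Adj G s q → ⊥
        LongPath-crossed (longPath {P} w u l _ bonds) b s≢p s≢q rp sp rq sq =
          [ (λ b′ → not-longer (crossing w u b′ rq sp)) , (λ b′ → not-longer (crossing w u b′ sq rp)) ]′
            (bonds b s≢p s≢q)
          where
          not-longer : ¬ ∃ λ D → Cycle D × length D ≡ length P
          not-longer (_ , d , eq) = ℕ.<⇒≱ l (subst (_≤ length C) eq (longest d))

        no-outside-bond : ∀ {r s} → Bond r s C → r ∈ I ⊎ s ∈ I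
        no-outside-bond {r} {s} b = decidable-stable (r ∈? I ⊎-dec s ∈? I) λ ¬either →
          cross (¬either ∘ inj₂) (two-common (¬either ∘ inj₁) (¬either ∘ inj₂))
          where
          cross : s ∉ I → ¬ ∃₂ λ p q → p ≢ q ×
            (p ∈ W⁺ × Adj G r p × Adj G s p) × (q ∈ W⁺ × Adj G r q × Adj G s q)
          cross s∉ (_ , _ , p≢q , (p∈ , rp , sp) , (q∈ , rq , sq)) =
            LongPath-crossed (W⁺-longPath p∈ q∈ p≢q) b
              -- The pairs of `C` that the path may lose end in `p` or `q`, which lie in `I`,
              -- whereas `s` does not.
              (λ { refl → s∉ (W⁺⊆I p∈) }) (λ { refl → s∉ (W⁺⊆I q∈) }) rp sp rq sq

        -- This is all of V - I, by `outside⊆C`.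
        rest : List V
        rest = filter (¬? ∘ (_∈? I)) C

        outside≤ : length rest ≤ suc (length I)
        outside≤ = ℕ.≤-trans (length-filter-sparse (_∈? I) C no-outside-bond)
          (s≤s (unique-⊆⇒length≤ (Unique.filter⁺ (_∈? I) C-unique) (proj₂ ∘ ∈-filter⁻ (_∈? I) {xs = C})))

        6≤k : 6 ≤ length I
        6≤k = ℕ.≤-trans 6≤∣W⁺∣ (unique-⊆⇒length≤ W⁺-unique W⁺⊆I)

        -- Deleting `rest` leaves only vertices of `I`, and these span no edge.
        I-apart : ∀ {u v} → u ∈ I → Star (AdjMinus G (fromList rest)) u v → u ≡ v
        I-apart u∈ ε = refl
        I-apart u∈ (_◅_ {j = v} (_ , v∉rest , e) _) with v ∈? I
        ... | yes v∈ = contradiction e (I-indep u∈ v∈)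
        ... | no v∉  = contradiction
          (∈-fromList⁺ (∈-filter⁺ (¬? ∘ (_∈? I)) (outside⊆C v∉) v∉)) v∉rest

        3k≤ : 3 * length I ≤ length rest
        3k≤ = tough-separation 3 tough rest I (ℕ.≤-trans (s≤s (s≤s z≤n)) 6≤k)
          (λ z∈ z∈rest → proj₂ (∈-filter⁻ (¬? ∘ (_∈? I)) {xs = C} z∈rest) z∈)
          (λ i j i≢j (_ , _ , r) → i≢j (lookup-injective I! (I-apart (∈-lookup i) r)))

        1+k<3k : suc (length I) < 3 * length I
        1+k<3k = begin-strict
          1 + length I                       <⟨ ℕ.+-monoˡ-< (length I) (ℕ.<-≤-trans (s≤s (s≤s z≤n)) 6≤k) ⟩
          length I + length I                ≤⟨ ℕ.+-monoʳ-≤ (length I) (ℕ.m≤m+n _ _) ⟩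
          length I + (length I + (length I + 0)) ∎
          where open ≤-Reasoning

        absurd : ⊥
        absurd = ℕ.<⇒≱ 1+k<3k (ℕ.≤-trans 3k≤ outside≤)

      not-longest : ⊥
      not-longest = let _ , sub , uq , indep , dom = extend-independent (allFin n) W⁺-unique W⁺-independent
        in Dominating.absurd sub uq indep dom

  -- Lengthening cycles until one spans.

  nonspanning⇒longer : Tough 3 G → Free K2∪3K1 G → ∀ {C x} → Cycle C → x ∉ C →
    ¬ ¬ ∃ λ D → Cycle D × length C < length D
  nonspanning⇒longer tough free {C} c x∉ ¬longer =
    -- There are finitely many vertices, so the double negations of the single decisions combine
    -- into one.
    sequence (RawMonad.rawApplicative ¬¬-Monad) (λ v → ¬¬-excluded-middle) (λ near? →
      LongestCycle.Neighbourhood.not-longest tough free c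
        (λ d → ℕ.≮⇒≥ (λ lt → ¬longer (_ , d , lt))) x∉ near?)

  SpanningCycle : Set
  SpanningCycle = ∃ λ C → length C ≡ n × Cycle C

  spanning-cycle : Tough 3 G → Free K2∪3K1 G → 3 ≤ n → SpanningCycle
  spanning-cycle tough free 3≤n = decidable-stable (∃-length? cycle? n) λ ¬spanning →
    arbitrarily-long ¬spanning (suc n) λ (_ , c , lt) → ℕ.<⇒≱ lt (length≤n (Cycle.unique c))
    where
    misses : ¬ SpanningCycle → ∀ {C} → Cycle C → ∃ λ x → x ∉ C
    misses ¬spanning {C} c = decidable-stable (any? λ x → ¬? (x ∈? C)) λ ¬misses →
      ¬spanning (C , ℕ.≤-antisym (length≤n (Cycle.unique c)) (n≤length λ v →
        decidable-stable (v ∈? C) (λ v∉ → ¬misses (v , v∉))) , c)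

    arbitrarily-long : ¬ SpanningCycle → ∀ k → ¬ ¬ ∃ λ C → Cycle C × k ≤ length C
    -- The starting cycle is an edge traversed back and forth.
    arbitrarily-long ¬spanning zero none with u , v , e ← hasEdge tough 3≤n =
      none (u ∷ v ∷ [] , cycle (step e stop) (sym G e) (((λ { refl → irrefl G e }) ∷ []) ∷ [] ∷ []) , z≤n)
    arbitrarily-long ¬spanning (suc k) none =
      arbitrarily-long ¬spanning k λ (_ , c , k≤) →
        nonspanning⇒longer tough free c (proj₂ (misses ¬spanning c)) λ (D , d , lt) →
          none (D , d , ℕ.≤-<-trans k≤ lt)

  -- From a spanning cycle to a cyclic permutation of the vertices.

  walk-lookup : ∀ {a b l k} → Walk a b l → length l ≡ suc k → ∃ λ (f : Fin (suc k) → V) →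
    f zero ≡ a × f (fromℕ k) ≡ b × (∀ i → Adj G (f (inject₁ i)) (f (suc i))) ×
    (Unique l → ∀ {i j} → f i ≡ f j → i ≡ j) × (∀ {v} → v ∈ l → ∃ λ i → f i ≡ v)
  walk-lookup {l = l@(_ ∷ _)} w refl = lookup l , first w , last w , linked w , lookup-injective ,
    λ v∈ → Any.index v∈ , ≡.sym (lookup-index v∈)
    where
    first : ∀ {a b x l} → Walk a b (x ∷ l) → x ≡ a
    first stop       = refl
    first (step _ _) = refl

    last : ∀ {a b x l} → Walk a b (x ∷ l) → lookup (x ∷ l) (fromℕ (length l)) ≡ b
    last stop                  = refl
    last (step _ w@stop)       = last w
    last (step _ w@(step _ _)) = last w

    linked : ∀ {a b x l} → Walk a b (x ∷ l) → ∀ (i : Fin (length l)) →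
      Adj G (lookup (x ∷ l) (inject₁ i)) (lookup l i)
    linked (step e stop)         zero    = e
    linked (step e (step _ _))   zero    = e
    linked (step e w@(step _ _)) (suc i) = linked w i

spanning⇒hamiltonian : ∀ {m} (G : Graph (suc m)) → SpanningCycle G → Hamiltonian G
spanning⇒hamiltonian {m} G (C , len , cycle w closing u)
  with f , refl , refl , linked , inj , onto ← walk-lookup G w len =
  permutation f g (λ v → proj₂ (pre v)) (λ i → inj u (proj₂ (pre (f i)))) , linked , closing
  where
  open DecMembership (_≟_ {suc m}) using (_∈?_)

  all∈ : ∀ v → v ∈ C
  -- A missed vertex put in front of `C` would give `m` + 2 distinct elements of a set of size `m` +
  -- 1.
  all∈ v = decidable-stable (v ∈? C) λ v∉ →
    ℕ.<⇒≱ (ℕ.≤-reflexive (cong suc (≡.sym len))) (length≤n (∷-unique v∉ u))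

  pre : ∀ v → ∃ λ i → f i ≡ v
  pre v = onto (all∈ v)

  g : Fin (suc m) → Fin (suc m)
  g v = proj₁ (pre v)

theorem1p1 : ∀ {n : ℕ} (G : Graph n) → 3 ≤ n → Tough 3 G → Free K2∪3K1 G → Hamiltonian G
theorem1p1 G 3≤n@(s≤s _) tough free = spanning⇒hamiltonian G (spanning-cycle G tough free 3≤n)
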